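{- For every instance of the day-invariant fair repetitive scheduling problem with $m$ days and processing times $(p_j)_{j\in[n]}$, letting $P=\sum_{j\in[n]}p_j$ and $p_{\max}=\max_{j\in[n]}p_j$, the optimal value $K^*$ satisfies $$K^*\ \ge\ \frac m2\cdot\left(P+\frac{p_{\max}^2}{P}\right).$$
   Context: Notation: $[k]=\{1,\dots,k\}$. An instance of the day-invariant fair repetitive scheduling problem consists of $n$ clients, $m$ days, and a positive integer processing time $p_j$ for each client $j\in[n]$; on every day $i\in[m]$ client $j$ has a job $(i,j)$ of processing time $p_j$, and each day's jobs are processed non-preemptively on a single machine from time $0$. A schedule is a sequence $\pi=(\pi_1,\dots,\pi_m)$ of permutations of $[n]$, where $\pi_i(j)$ is the position of job $(i,j)$ on day $i$. The completion time of job $(i,j)$ is $C_{i,j}(\pi)=\sum_{\ell\in[n]:\,\pi_i(\ell)\le\pi_i(j)}p_{\ell}$, the total completion time of client $j$ is $C_j(\pi)=\sum_{i\in[m]}C_{i,j}(\pi)$, $K(\pi)=\max_{j\in[n]}C_j(\pi)$, and $K^*=\min_\pi K(\pi)$. -}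

module Defs where

open import Data.Bool.Base using (if_then_else_)
open import Data.Fin.Base using (Fin; zero; suc; punchIn; punchOut)
open import Data.Fin.Permutation as Perm
  using (Permutation′; _⟨$⟩ʳ_; _≈_; insert; remove; insert-remove)
open import Data.Fin.Properties using (_≟_; _≤?_)
open import Data.List.Base using (List; []; _∷_; map; tabulate; allFin; cartesianProductWith)
open import Data.List.Extrema.Nat using (min; max; min≤v⁺; argmin-sel)
open import Data.List.Membership.Propositional.Properties using (∈-allFin; ∈-map⁻)
open import Data.List.Properties using (tabulate-cong)
open import Data.List.Relation.Unary.Any as Any using (Any; here)
import Data.List.Relation.Unary.Any.Properties as Any
open import Data.Nat.Base using (ℕ; zero; suc; _≤_; _<_; NonZero; >-nonZero)
open import Data.Nat.Properties using (+-0-commutativeMonoid; ≤-reflexive; <-≤-trans; m≤m+n)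
open import Data.Product.Base using (∃; _,_)
open import Data.Sum.Base using (inj₁; inj₂)
open import Data.Vec.Functional as Vector using (Vector)
open import Function.Base using (id)
open import Relation.Binary.PropositionalEquality
  using (_≡_; refl; sym; trans; cong; cong₂)
open import Relation.Nullary using (does; yes; no)

open import Algebra.Properties.CommutativeMonoid.Sum +-0-commutativeMonoid public
  using (sum; sum-syntax; sum-cong-≗)

permutations : ∀ n → List (Permutation′ n)
permutations zero    = Perm.id ∷ []
permutations (suc n) = cartesianProductWith (insert zero) (allFin (suc n)) (permutations n)

vectors : ∀ {A : Set} m → List A → List (Vector A m)
vectors zero    xs = Vector.[] ∷ []
vectors (suc m) xs = cartesianProductWith Vector._∷_ xs (vectors m xs)

-- Completeness of the enumerations.  Without function extensionality it can
-- only be stated up to pointwise equality.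

insert-cong : ∀ {n} i j {π ρ : Permutation′ n} → π ≈ ρ → insert i j π ≈ insert i j ρ
insert-cong i j π≈ρ k with i ≟ k
... | yes _   = refl
... | no  i≢k = cong (punchIn j) (π≈ρ (punchOut i≢k))

permutations-complete : ∀ n (π : Permutation′ n) → Any (π ≈_) (permutations n)
permutations-complete zero    π = here λ ()
permutations-complete (suc n) π =
  Any.cartesianProductWith⁺ (insert zero) step
    (∈-allFin (π ⟨$⟩ʳ zero)) (permutations-complete n (remove zero π))
  where
  step : ∀ {j ρ} → π ⟨$⟩ʳ zero ≡ j → remove zero π ≈ ρ → π ≈ insert zero j ρ
  step {ρ = ρ} refl eq k = trans (sym (insert-remove zero π k))
    (insert-cong zero (π ⟨$⟩ʳ zero) {remove zero π} {ρ} eq k)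

vectors-complete : ∀ {A : Set} {R : A → A → Set} {xs} m (v : Vector A m) →
                   (∀ i → Any (R (v i)) xs) →
                   Any (λ w → ∀ i → R (v i) (w i)) (vectors m xs)
vectors-complete zero    v ps = here λ ()
vectors-complete {R = R} (suc m) v ps =
  Any.cartesianProductWith⁺ Vector._∷_
    (λ r rs → λ { zero → r ; (suc i) → rs i })
    (ps zero) (vectors-complete {R = R} m (Vector.tail v) λ i → ps (suc i))

-- At least one client is required: otherwise neither p-max nor K is a maximum
-- over a nonempty set, and P is zero.
record Instance : Set where
  field
    n m           : ℕ
    {{n-nonZero}} : NonZero n
    p             : Fin n → ℕ
    p-positive    : ∀ j → 0 < p j

  P : ℕ
  P = ∑[ j < n ] p j

  -- The default 0 never exceeds the maximum of a nonempty list of naturals;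
  -- likewise in K.
  p-max : ℕ
  p-max = max 0 (tabulate p)

  Schedule : Set
  Schedule = Vector (Permutation′ n) m

  completionTime : Schedule → Fin m → Fin n → ℕ
  completionTime π i j =
    ∑[ ℓ < n ] (if does ((π i ⟨$⟩ʳ ℓ) ≤? (π i ⟨$⟩ʳ j)) then p ℓ else 0)

  totalCompletionTime : Schedule → Fin n → ℕ
  totalCompletionTime π j = ∑[ i < m ] completionTime π i j

  K : Schedule → ℕ
  K π = max 0 (tabulate (totalCompletionTime π))

  -- The first argument of min, the value of the schedule using the identity
  -- every day, only serves to make the minimum total.
  K* : ℕ
  K* = min (K (λ _ → Perm.id)) (map K (vectors m (permutations n)))

  K-cong : ∀ (π ρ : Schedule) → (∀ i → π i ≈ ρ i) → K π ≡ K ρ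
  K-cong π ρ eq = cong (max 0) (tabulate-cong λ j → sum-cong-≗ λ i → sum-cong-≗ λ ℓ →
    cong₂ (λ (a b : Fin n) → if does (a ≤? b) then p ℓ else 0) (eq i ℓ) (eq i j))

  K*-attained : ∃ λ π → K* ≡ K π
  K*-attained with argmin-sel id (K (λ _ → Perm.id)) (map K (vectors m (permutations n)))
  ... | inj₁ eq = (λ _ → Perm.id) , eq
  ... | inj₂ K*∈ with ∈-map⁻ K K*∈
  ...   | π , _ , eq = π , eq

  K*-minimal : ∀ π → K* ≤ K π
  K*-minimal π = min≤v⁺ _ (map K (vectors m (permutations n))) (inj₂ (Any.map⁺
    (Any.map (λ {ρ} eq → ≤-reflexive (sym (K-cong π ρ eq)))
      (vectors-complete {R = _≈_} m π λ i → permutations-complete n (π i)))))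

  instance
    P-nonZero : NonZero P
    P-nonZero = >-nonZero (sum-positive n p p-positive)
      where
      sum-positive : ∀ k .{{_ : NonZero k}} (f : Fin k → ℕ) → (∀ j → 0 < f j) → 0 < sum f
      sum-positive (suc k) f f>0 = <-≤-trans (f>0 zero) (m≤m+n (f zero) _)

{-# OPTIONS --safe #-}

-- On a single day, each pair of distinct clients j, ℓ contributes p j * p ℓ to
-- the weighted sum Σ_j p j * C_j exactly once, because one of the two precedes
-- the other, and each client j contributes p j * p j.  Hence twice this sum is
-- P² + Σ_j (p j)² ≥ P² + p-max², whatever the permutation.  Summing over the
-- days and bounding each total completion time by K gives
-- m * (P² + p-max²) ≤ 2 * P * K.
module Submission where

open import Defs
open import Algebra.Properties.Semiring.Sum using (*-distribˡ-sum; *-distribʳ-sum)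
open import Algebra.Properties.CommutativeMonoid.Sum using (∑-distrib-+; ∑-comm)
open import Data.Bool.Base using (if_then_else_)
open import Data.Empty using (⊥-elim)
open import Data.Fin.Base using (Fin; zero; suc)
open import Data.Fin.Permutation using (_⟨$⟩ʳ_)
import Data.Fin.Properties as Fin
open import Data.Integer.Base as ℤ using (+_)
import Data.Integer.Properties as ℤ
import Data.List.Base as List
open import Data.List.Extrema.Nat using (max; argmax-sel; v≤max⁺)
open import Data.List.Membership.Propositional.Properties using (∈-tabulate⁻)
import Data.List.Relation.Unary.Any.Properties as Any
open import Data.Nat.Base as ℕ using (ℕ; zero; suc; NonZero; _^_; z≤n)
import Data.Nat.Properties as ℕ
open import Data.Nat.Tactic.RingSolver using (solve-∀)
open import Data.Product.Base using (_,_)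
open import Data.Rational.Base using (_/_; _+_; _*_; _≥_; toℚᵘ)
open import Data.Rational.Properties
  using (toℚᵘ-cancel-≤; toℚᵘ-fromℚᵘ; toℚᵘ-homo-+; toℚᵘ-homo-*)
open import Data.Rational.Unnormalised.Base as ℚᵘ using (mkℚᵘ; *≤*)
import Data.Rational.Unnormalised.Properties as ℚᵘ
open import Data.Sum.Base using (inj₁; inj₂; [_,_]′)
open import Function.Base using (_∘_; id)
open import Level using (0ℓ)
open import Relation.Binary.Core using (Rel)
open import Relation.Binary.Definitions using (Decidable; Total)
open import Relation.Binary.PropositionalEquality
  using (_≡_; refl; sym; trans; cong; subst₂)
open import Relation.Nullary using (does; yes; no; contradiction)
open import Relation.Nullary.Decidable using (dec-true)

sum-mono-≤ : ∀ {n} {f g : Fin n → ℕ} → (∀ i → f i ℕ.≤ g i) → sum f ℕ.≤ sum g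
sum-mono-≤ {zero}  f≤g = z≤n
sum-mono-≤ {suc n} f≤g = ℕ.+-mono-≤ (f≤g zero) (sum-mono-≤ (f≤g ∘ suc))

*-≤-sum : ∀ {n c} {f : Fin n → ℕ} → (∀ i → c ℕ.≤ f i) → n ℕ.* c ℕ.≤ sum f
*-≤-sum {zero}  c≤f = z≤n
*-≤-sum {suc n} c≤f = ℕ.+-mono-≤ (c≤f zero) (*-≤-sum (c≤f ∘ suc))

term-≤-sum : ∀ {n} (f : Fin n → ℕ) j → f j ℕ.≤ sum f
term-≤-sum f zero    = ℕ.m≤m+n _ _
term-≤-sum f (suc j) = ℕ.≤-trans (term-≤-sum (f ∘ suc) j) (ℕ.m≤n+m _ (f zero))

sum-*-sum : ∀ {m n} (f : Fin m → ℕ) (g : Fin n → ℕ) →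
            sum f ℕ.* sum g ≡ ∑[ i < m ] ∑[ j < n ] (f i ℕ.* g j)
sum-*-sum f g = trans (*-distribʳ-sum ℕ.+-*-semiring (sum g) f)
  (sum-cong-≗ λ i → *-distribˡ-sum ℕ.+-*-semiring (f i) g)

-- The maximum is either the default 0, where the bound is trivial, or a value of `f`, so that its
-- square is one of the summands.
max-square-≤-sum : ∀ {n} (f : Fin n → ℕ) →
                   max 0 (List.tabulate f) ℕ.* max 0 (List.tabulate f) ℕ.≤ ∑[ j < n ] (f j ℕ.* f j)
max-square-≤-sum f with argmax-sel id 0 (List.tabulate f)
... | inj₁ max≡0 rewrite max≡0 = z≤n
... | inj₂ max∈ with ∈-tabulate⁻ max∈
...   | j , max≡fj rewrite max≡fj = term-≤-sum (λ j → f j ℕ.* f j) j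

-- The relation `≼` stands for the order of the clients by position on a single day.
module _ {n} (p : Fin n → ℕ) {_≼_ : Rel (Fin n) 0ℓ} (≼-total : Total _≼_)
         (_≼?_ : Decidable _≼_) where

  precedes : Fin n → Fin n → ℕ
  precedes ℓ j = if does (ℓ ≼? j) then p ℓ else 0

  -- Writes the squares as a double sum supported on `j ≡ ℓ`, so that they can be compared term by
  -- term with the other double sums.
  diagonal : Fin n → Fin n → ℕ
  diagonal j ℓ = if does (j Fin.≟ ℓ) then p j ℕ.* p j else 0

  square-≤-diagonal : ∀ j → p j ℕ.* p j ℕ.≤ ∑[ ℓ < n ] diagonal j ℓ
  square-≤-diagonal j = ℕ.≤-trans
    (ℕ.≤-reflexive (sym (cong (λ b → if b then p j ℕ.* p j else 0) (dec-true (j Fin.≟ j) refl))))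
    (term-≤-sum (diagonal j) j)

  -- The right side counts the pair in both orders. By totality at least one of its terms equals
  -- `p j * p ℓ`; for `j ≡ ℓ` both do, which pays for the extra square.
  pair-bound : ∀ j ℓ → p j ℕ.* p ℓ ℕ.+ diagonal j ℓ ℕ.≤
                       p j ℕ.* precedes ℓ j ℕ.+ p ℓ ℕ.* precedes j ℓ
  pair-bound j ℓ with j Fin.≟ ℓ | ℓ ≼? j | j ≼? ℓ
  ... | yes refl | yes _  | yes _  = ℕ.≤-refl
  ... | no _     | yes _  | _      = ℕ.+-monoʳ-≤ (p j ℕ.* p ℓ) z≤n
  ... | yes refl | yes a  | no ¬a  = contradiction a ¬a
  ... | _        | no ℓ⋠j | no j⋠ℓ = ⊥-elim ([ ℓ⋠j , j⋠ℓ ]′ (≼-total ℓ j))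
  ... | yes refl | no ¬a  | yes a  = contradiction a ¬a
  ... | no _     | no _   | yes _  = ℕ.≤-reflexive (swap (p j) (p ℓ))
    where
    swap : ∀ a b → a ℕ.* b ℕ.+ 0 ≡ a ℕ.* 0 ℕ.+ b ℕ.* a
    swap = solve-∀

  weighted-sum-bound :
    sum p ℕ.* sum p ℕ.+ ∑[ j < n ] (p j ℕ.* p j) ℕ.≤
    2 ℕ.* ∑[ j < n ] (p j ℕ.* ∑[ ℓ < n ] precedes ℓ j)
  weighted-sum-bound = begin
    sum p ℕ.* sum p ℕ.+ ∑[ j < n ] (p j ℕ.* p j)
      ≤⟨ ℕ.+-mono-≤ (ℕ.≤-reflexive (sum-*-sum p p)) (sum-mono-≤ square-≤-diagonal) ⟩
    ∑[ j < n ] ∑[ ℓ < n ] (p j ℕ.* p ℓ) ℕ.+ ∑[ j < n ] ∑[ ℓ < n ] diagonal j ℓ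
      ≡⟨ ∑∑-distrib-+ _ _ ⟨
    ∑[ j < n ] ∑[ ℓ < n ] (p j ℕ.* p ℓ ℕ.+ diagonal j ℓ)
      ≤⟨ sum-mono-≤ (λ j → sum-mono-≤ (pair-bound j)) ⟩
    ∑[ j < n ] ∑[ ℓ < n ] (p j ℕ.* precedes ℓ j ℕ.+ p ℓ ℕ.* precedes j ℓ)
      ≡⟨ ∑∑-distrib-+ _ _ ⟩
    W ℕ.+ ∑[ j < n ] ∑[ ℓ < n ] (p ℓ ℕ.* precedes j ℓ)
      -- Exchanging the two sums and renaming the indices turns the second double sum into `W`.
      ≡⟨ cong (W ℕ.+_) (∑-comm ℕ.+-0-commutativeMonoid (λ j ℓ → p ℓ ℕ.* precedes j ℓ)) ⟩
    W ℕ.+ W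
      ≡⟨ cong (W ℕ.+_) (ℕ.+-identityʳ W) ⟨
    2 ℕ.* W
      ≡⟨ cong (2 ℕ.*_) (sum-cong-≗ λ j → *-distribˡ-sum ℕ.+-*-semiring (p j) (λ ℓ → precedes ℓ j)) ⟨
    2 ℕ.* ∑[ j < n ] (p j ℕ.* ∑[ ℓ < n ] precedes ℓ j) ∎
    where
    open ℕ.≤-Reasoning
    W = ∑[ j < n ] ∑[ ℓ < n ] (p j ℕ.* precedes ℓ j)

    ∑∑-distrib-+ : ∀ (f g : Fin n → Fin n → ℕ) →
      ∑[ j < n ] ∑[ ℓ < n ] (f j ℓ ℕ.+ g j ℓ) ≡
      ∑[ j < n ] ∑[ ℓ < n ] f j ℓ ℕ.+ ∑[ j < n ] ∑[ ℓ < n ] g j ℓ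
    ∑∑-distrib-+ f g = trans
      (sum-cong-≗ λ j → ∑-distrib-+ ℕ.+-0-commutativeMonoid (f j) (g j))
      (∑-distrib-+ ℕ.+-0-commutativeMonoid (λ j → sum (f j)) (λ j → sum (g j)))

module _ (I : Instance) where

  open Instance I

  totalCompletionTime-≤-K : ∀ π j → totalCompletionTime π j ℕ.≤ K π
  totalCompletionTime-≤-K π j =
    v≤max⁺ 0 _ (inj₂ (Any.tabulate⁺ {f = totalCompletionTime π} j ℕ.≤-refl))

  K-bound : ∀ π → m ℕ.* (P ℕ.* P ℕ.+ p-max ^ 2) ℕ.≤ 2 ℕ.* (P ℕ.* K π)
  K-bound π = begin
    m ℕ.* (P ℕ.* P ℕ.+ p-max ^ 2)
      -- `p-max ^ 2` unfolds to `p-max * (p-max * 1)`.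
      ≡⟨ cong (λ q → m ℕ.* (P ℕ.* P ℕ.+ p-max ℕ.* q)) (ℕ.*-identityʳ p-max) ⟩
    m ℕ.* (P ℕ.* P ℕ.+ p-max ℕ.* p-max)
      ≤⟨ *-≤-sum day-bound ⟩
    ∑[ i < m ] (2 ℕ.* ∑[ j < n ] (p j ℕ.* completionTime π i j))
      ≡⟨ *-distribˡ-sum ℕ.+-*-semiring 2 (λ i → ∑[ j < n ] (p j ℕ.* completionTime π i j)) ⟨
    2 ℕ.* ∑[ i < m ] ∑[ j < n ] (p j ℕ.* completionTime π i j)
      ≡⟨ cong (2 ℕ.*_) (∑-comm ℕ.+-0-commutativeMonoid (λ i j → p j ℕ.* completionTime π i j)) ⟩
    2 ℕ.* ∑[ j < n ] ∑[ i < m ] (p j ℕ.* completionTime π i j)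
      ≡⟨ cong (2 ℕ.*_) (sum-cong-≗ λ j →
           *-distribˡ-sum ℕ.+-*-semiring (p j) (λ i → completionTime π i j)) ⟨
    2 ℕ.* ∑[ j < n ] (p j ℕ.* totalCompletionTime π j)
      ≤⟨ ℕ.*-monoʳ-≤ 2 (sum-mono-≤ λ j → ℕ.*-monoʳ-≤ (p j) (totalCompletionTime-≤-K π j)) ⟩
    2 ℕ.* ∑[ j < n ] (p j ℕ.* K π)
      ≡⟨ cong (2 ℕ.*_) (*-distribʳ-sum ℕ.+-*-semiring (K π) p) ⟨
    2 ℕ.* (P ℕ.* K π) ∎
    where
    open ℕ.≤-Reasoning

    day-bound : ∀ i → P ℕ.* P ℕ.+ p-max ℕ.* p-max ℕ.≤
                      2 ℕ.* ∑[ j < n ] (p j ℕ.* completionTime π i j)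
    day-bound i = ℕ.≤-trans (ℕ.+-monoʳ-≤ (P ℕ.* P) (max-square-≤-sum p))
      -- For the order by position under `π i`, the sum of `precedes ℓ j` over `ℓ` is
      -- `completionTime π i j` by definition.
      (weighted-sum-bound p
        (λ ℓ j → Fin.≤-total (π i ⟨$⟩ʳ ℓ) (π i ⟨$⟩ʳ j))
        (λ ℓ j → (π i ⟨$⟩ʳ ℓ) Fin.≤? (π i ⟨$⟩ʳ j)))

-- Unnormalised rationals are not reduced to lowest terms, so there the inequality is the
-- cross-multiplied one over the integers, which is `bound` up to factors of 1 and reordering.
clear-denominators : ∀ k m P q .{{_ : NonZero P}} → m ℕ.* (P ℕ.* P ℕ.+ q) ℕ.≤ 2 ℕ.* (P ℕ.* k) →
                     (+ k / 1) ≥ (+ m / 2) * ((+ P / 1) + (+ q / P))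
clear-denominators k m P@(suc d) q bound = toℚᵘ-cancel-≤ (begin
  toℚᵘ ((+ m / 2) * ((+ P / 1) + (+ q / P)))
    ≃⟨ toℚᵘ-homo-* (+ m / 2) _ ⟩
  toℚᵘ (+ m / 2) ℚᵘ.* toℚᵘ ((+ P / 1) + (+ q / P))
    -- `mkℚᵘ` takes the denominator minus one: 1, 0 and `d` encode the denominators 2, 1 and `P`.
    ≃⟨ ℚᵘ.*-cong (toℚᵘ-fromℚᵘ (mkℚᵘ (+ m) 1)) (ℚᵘ.≃-trans (toℚᵘ-homo-+ (+ P / 1) (+ q / P))
         (ℚᵘ.+-cong (toℚᵘ-fromℚᵘ (mkℚᵘ (+ P) 0)) (toℚᵘ-fromℚᵘ (mkℚᵘ (+ q) d)))) ⟩
  mkℚᵘ (+ m) 1 ℚᵘ.* (mkℚᵘ (+ P) 0 ℚᵘ.+ mkℚᵘ (+ q) d)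
    ≤⟨ *≤* (subst₂ ℤ._≤_ numerator denominator (ℤ.+≤+ bound)) ⟩
  mkℚᵘ (+ k) 0
    ≃⟨ toℚᵘ-fromℚᵘ (mkℚᵘ (+ k) 0) ⟨
  toℚᵘ (+ k / 1) ∎)
  where
  open ℚᵘ.≤-Reasoning

  numerator : + (m ℕ.* (P ℕ.* P ℕ.+ q)) ≡ + m ℤ.* (+ P ℤ.* + P ℤ.+ + q ℤ.* + 1) ℤ.* + 1
  numerator = trans (ℤ.pos-* m _) (sym (trans (ℤ.*-identityʳ _)
    (cong (λ x → + m ℤ.* (+ (P ℕ.* P) ℤ.+ x)) (ℤ.*-identityʳ (+ q)))))

  denominator : + (2 ℕ.* (P ℕ.* k)) ≡ + k ℤ.* + (2 ℕ.* (1 ℕ.* P))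
  denominator = trans (cong +_ (rearrange P k)) (ℤ.pos-* k _)
    where
    rearrange : ∀ P k → 2 ℕ.* (P ℕ.* k) ≡ k ℕ.* (2 ℕ.* (1 ℕ.* P))
    rearrange = solve-∀

lemma4p1 : (I : Instance) → let open Instance I in
    (+ K* / 1) ≥ (+ m / 2) * ((+ P / 1) + (+ (p-max ^ 2) / P))
-- The bound holds for every schedule, hence for one whose value is `K*`.
lemma4p1 I with Instance.K*-attained I
... | π , K*≡K = clear-denominators K* m P (p-max ^ 2) (ℕ.≤-trans (K-bound I π)
  (ℕ.≤-reflexive (cong (λ k → 2 ℕ.* (P ℕ.* k)) (sym K*≡K))))
  where open Instance I
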